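{- Let $X$ be one of the logics $\mathbf{KD}$, $\mathbf{KD4}$ and $\mathbf{KB}$. Then $B$-translation is faithful with respect to $X$; that is, for every formula $\phi$ of $\mathbf{L_1}$, $\vdash_X B(\phi)$ implies $\vdash_{\mathbf{L_1}}\phi$.
   Context: The system $\mathbf{L_1}$ (Leśniewski's propositional ontology): fix a countably infinite set of name variables. The atomic formulas are exactly the expressions $\epsilon ab$ with $a,b$ name variables (possibly equal); formulas are built from atomic formulas by $\vee$ and $\neg$, the other connectives being the usual classical abbreviations. $\mathbf{L_1}$ is a Hilbert-style system of classical propositional logic (with modus ponens) over these formulas with the additional axiom schemata, for all name variables $a,b,c$: (Ax1) $\epsilon ab \supset \epsilon aa$; (Ax2) $(\epsilon ab \wedge \epsilon bc) \supset \epsilon ac$; (Ax3) $(\epsilon ab \wedge \epsilon bc) \supset \epsilon ba$. $B$-translation: to each name variable $a$ corresponds a propositional variable $p_a$, with distinct name variables corresponding to distinct propositional variables. $B$ maps formulas of $\mathbf{L_1}$ to propositional modal formulas by $B(\phi\vee\psi)=B(\phi)\vee B(\psi)$, $B(\neg\phi)=\neg B(\phi)$, $B(\epsilon ab)=p_a\wedge\Box(p_a\supset p_b)\wedge\bigl(p_b\supset\Box(p_b\supset p_a)\bigr)$. The logics are the smallest normal modal logics (containing $\mathbf{K}$, closed under modus ponens, substitution and necessitation) containing the following schemata: $\mathbf{KD}$: $\Box\phi\supset\Diamond\phi$; $\mathbf{KD4}$: $\Box\phi\supset\Diamond\phi$ and $\Box\phi\supset\Box\Box\phi$; $\mathbf{KB}$: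 $\phi\supset\Box\Diamond\phi$. -}

module Defs where

open import Data.Nat.Base using (ℕ)
open import Function.Bundles using (_↣_; module Injection)

NameVar PropVar : Set
NameVar = ℕ
PropVar = ℕ

-- Both languages have ¬ and ∨ as their Boolean primitives, so they share
-- the classical abbreviations and a complete axiomatisation of classical
-- propositional logic (with modus ponens): the Hilbert–Ackermann schemata.
module Classical {F : Set} (¬_ : F → F) (_∨_ : F → F → F) where

  infixr 6 _∧_
  infixr 4 _⊃_

  _⊃_ : F → F → F
  φ ⊃ ψ = (¬ φ) ∨ ψ

  _∧_ : F → F → F
  φ ∧ ψ = ¬ ((¬ φ) ∨ (¬ ψ))

  data Axiom : F → Set where
    idem : ∀ φ     → Axiom ((φ ∨ φ) ⊃ φ)
    add  : ∀ φ ψ   → Axiom (φ ⊃ (φ ∨ ψ))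
    perm : ∀ φ ψ   → Axiom ((φ ∨ ψ) ⊃ (ψ ∨ φ))
    summ : ∀ φ ψ χ → Axiom ((ψ ⊃ χ) ⊃ ((φ ∨ ψ) ⊃ (φ ∨ χ)))

module L₁ where

  infix  8 ¬_
  infixr 5 _∨_
  infix  3 ⊢_

  data Formula : Set where
    ε   : NameVar → NameVar → Formula
    ¬_  : Formula → Formula
    _∨_ : Formula → Formula → Formula

  open Classical ¬_ _∨_ public

  data ⊢_ : Formula → Set where
    classical : ∀ {φ} → Axiom φ → ⊢ φ
    ax1 : ∀ a b   → ⊢ ε a b ⊃ ε a a
    ax2 : ∀ a b c → ⊢ ε a b ∧ ε b c ⊃ ε a c
    ax3 : ∀ a b c → ⊢ ε a b ∧ ε b c ⊃ ε b a
    mp  : ∀ {φ ψ} → ⊢ φ ⊃ ψ → ⊢ φ → ⊢ ψ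

module Modal where

  infix  8 ¬_ □_ ◇_
  infixr 5 _∨_
  infix  3 _⊢_

  data Formula : Set where
    var : PropVar → Formula
    ¬_  : Formula → Formula
    _∨_ : Formula → Formula → Formula
    □_  : Formula → Formula

  open Classical ¬_ _∨_ public

  ◇_ : Formula → Formula
  ◇ φ = ¬ □ ¬ φ

  substitute : (PropVar → Formula) → Formula → Formula
  substitute σ (var x) = σ x
  substitute σ (¬ φ)   = ¬ substitute σ φ
  substitute σ (φ ∨ ψ) = substitute σ φ ∨ substitute σ ψ
  substitute σ (□ φ)   = □ substitute σ φ

  data Logic : Set where
    KD KD4 KB : Logic

  data Schema : Logic → Formula → Set where
    KD-D  : ∀ φ → Schema KD  (□ φ ⊃ ◇ φ)
    KD4-D : ∀ φ → Schema KD4 (□ φ ⊃ ◇ φ)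
    KD4-4 : ∀ φ → Schema KD4 (□ φ ⊃ □ □ φ)
    KB-B  : ∀ φ → Schema KB  (φ ⊃ □ ◇ φ)

  -- X ⊢_ is the smallest normal modal logic containing the schemata of X.
  data _⊢_ (X : Logic) : Formula → Set where
    classical : ∀ {φ} → Axiom φ → X ⊢ φ
    axK       : ∀ φ ψ → X ⊢ □ (φ ⊃ ψ) ⊃ (□ φ ⊃ □ ψ)
    schema    : ∀ {φ} → Schema X φ → X ⊢ φ
    mp        : ∀ {φ ψ} → X ⊢ φ ⊃ ψ → X ⊢ φ → X ⊢ ψ
    sub       : ∀ {φ} (σ : PropVar → Formula) → X ⊢ φ → X ⊢ substitute σ φ
    nec       : ∀ {φ} → X ⊢ φ → X ⊢ □ φ

-- The injection p sends the name variable a to its propositional variable p_a.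
B : NameVar ↣ PropVar → L₁.Formula → Modal.Formula
B p (L₁.ε a b) = pa ∧ □ (pa ⊃ pb) ∧ (pb ⊃ □ (pb ⊃ pa))
  where
  open Modal
  pa pb : Formula
  pa = var (Injection.to p a)
  pb = var (Injection.to p b)
B p (L₁.¬ φ)   = Modal.¬ B p φ
B p (φ L₁.∨ ψ) = B p φ Modal.∨ B p ψ

{-# OPTIONS --safe #-}

-- A valuation satisfying Ax1–Ax3 is turned into a Kripke model with a root
-- and one leaf for every name c: put p_a at the root iff ε a a, and p_a at
-- the leaf c iff ε c a.  The root sees exactly the leaves; a leaf sees itself
-- for KD and KD4 (the frame is then serial and transitive) and the root for
-- KB (the frame is then symmetric).  At the root, B (ε a b) is equivalent to
-- ε a b.  Only finitely many names matter, so □ is a finite conjunction and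
-- "ψ holds at w" can itself be written as a formula of L₁; soundness of X for
-- the frame then yields derivations in L₁ directly, and no completeness
-- theorem for L₁ is needed.
module Submission where

open import Defs
open import Data.Fin.Base using (Fin; zero; suc)
open import Data.Fin.Properties using (any?)
open import Data.List.Base using (List; []; _∷_; _++_; length; lookup)
open import Data.List.Membership.Propositional using (_∈_)
open import Data.List.Membership.Propositional.Properties using (∈-++⁺ˡ; ∈-++⁺ʳ)
open import Data.List.Relation.Binary.Subset.Propositional using (_⊆_)
open import Data.List.Relation.Unary.Any using (here; there; index)
open import Data.List.Relation.Unary.Any.Properties using (lookup-index)
open import Data.Nat.Base using (ℕ; zero; suc)
open import Data.Nat.Properties using (_≟_)
open import Data.Product.Base using (_×_; _,_; proj₂)
open import Function.Base using (_∘_)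
open import Function.Bundles using (_↣_; module Injection)
open import Relation.Binary.PropositionalEquality using (_≡_; refl; sym; trans; cong; cong₂; subst)
open import Relation.Nullary using (yes; no; contradiction)
open L₁

private variable
  φ φ′ ψ ψ′ χ : Formula
  Γ Δ : List Formula

-- Natural deduction over `L₁`.

infix 3 _⊩_

data _⊩_ (Γ : List Formula) : Formula → Set where
  assume : φ ∈ Γ → Γ ⊩ φ
  thm    : ⊢ φ → Γ ⊩ φ
  _·_    : Γ ⊩ φ ⊃ ψ → Γ ⊩ φ → Γ ⊩ ψ

infixl 9 _·_

axiom : Axiom φ → Γ ⊩ φ
axiom ax = thm (classical ax)

closed : [] ⊩ φ → ⊢ φ
closed (thm d) = d
closed (d · e) = mp (closed d) (closed e)

weaken : Γ ⊆ Δ → Γ ⊩ φ → Δ ⊩ φ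
weaken s (assume i) = assume (s i)
weaken s (thm d)    = thm d
weaken s (d · e)    = weaken s d · weaken s e

relax : φ ∷ [] ⊩ ψ → φ ∷ Γ ⊩ ψ
relax = weaken λ { (here eq) → here eq }

⊃-trans : Γ ⊩ φ ⊃ ψ → Γ ⊩ ψ ⊃ χ → Γ ⊩ φ ⊃ χ
⊃-trans d e = axiom (summ _ _ _) · e · d

⊃-refl : Γ ⊩ φ ⊃ φ
⊃-refl = ⊃-trans (axiom (add _ _)) (axiom (idem _))

∨-introˡ : Γ ⊩ φ → Γ ⊩ φ ∨ ψ
∨-introˡ d = axiom (add _ _) · d

∨-comm : Γ ⊩ φ ∨ ψ → Γ ⊩ ψ ∨ φ
∨-comm d = axiom (perm _ _) · d

∨-introʳ : Γ ⊩ ψ → Γ ⊩ φ ∨ ψ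
∨-introʳ d = ∨-comm (∨-introˡ d)

∨-elim-⊃ : Γ ⊩ φ ⊃ χ → Γ ⊩ ψ ⊃ χ → Γ ⊩ φ ∨ ψ ⊃ χ
∨-elim-⊃ d e =
  ⊃-trans (axiom (summ _ _ _) · e)
    (⊃-trans (axiom (perm _ _))
      (⊃-trans (axiom (summ _ _ _) · d) (axiom (idem _))))

∨-elim : Γ ⊩ φ ⊃ χ → Γ ⊩ ψ ⊃ χ → Γ ⊩ φ ∨ ψ → Γ ⊩ χ
∨-elim d e f = ∨-elim-⊃ d e · f

¬¬-intro : Γ ⊩ φ → Γ ⊩ ¬ ¬ φ
-- `φ ⊃ ¬ ¬ φ` unfolds to `¬ φ ∨ ¬ ¬ φ`, excluded middle for `¬ φ`.
¬¬-intro d = ∨-comm ⊃-refl · d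

⊃-apply : Γ ⊩ φ → Γ ⊩ (φ ⊃ ψ) ⊃ ψ
⊃-apply d = ∨-elim-⊃ (∨-introˡ (¬¬-intro d)) ⊃-refl

-- The modus ponens case of the deduction theorem. Split on the first premise, read as
-- `¬ φ ∨ (ψ ⊃ χ)`: the left disjunct yields `φ ⊃ χ` by `add`, the right one by `summ` and the
-- second premise.
⊃-distrib : Γ ⊩ φ ⊃ (ψ ⊃ χ) → Γ ⊩ φ ⊃ ψ → Γ ⊩ φ ⊃ χ
⊃-distrib d e =
  ∨-elim (axiom (add _ _)) (⊃-trans (axiom (summ _ _ _)) (⊃-apply e)) d

deduction : φ ∷ Γ ⊩ ψ → Γ ⊩ φ ⊃ ψ
deduction (assume (here refl)) = ⊃-refl
deduction (assume (there i))   = ∨-introʳ (assume i)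
deduction (thm d)              = ∨-introʳ (thm d)
deduction (d · e)              = ⊃-distrib (deduction d) (deduction e)

hyp₀ : φ ∷ Γ ⊩ φ
hyp₀ = assume (here refl)

hyp₁ : ψ ∷ φ ∷ Γ ⊩ φ
hyp₁ = assume (there (here refl))

explode : Γ ⊩ ¬ φ → Γ ⊩ φ → Γ ⊩ ψ
explode d e = ∨-introˡ d · e

¬-intro : φ ∷ Γ ⊩ ¬ φ → Γ ⊩ ¬ φ
¬-intro d = axiom (idem _) · deduction d

by-contradiction : ¬ φ ∷ Γ ⊩ φ → Γ ⊩ φ
-- The last `⊃-refl` serves as excluded middle `¬ φ ∨ φ`.
by-contradiction d = ∨-elim (deduction d) ⊃-refl ⊃-refl

contrapose : φ ∷ [] ⊩ ψ → ¬ ψ ∷ [] ⊩ ¬ φ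
contrapose d = ¬-intro (explode hyp₁ (relax d))

∨-map : φ ∷ [] ⊩ φ′ → ψ ∷ [] ⊩ ψ′ → (φ ∨ ψ) ∷ [] ⊩ φ′ ∨ ψ′
∨-map d e = ∨-elim (deduction (∨-introˡ (relax d))) (deduction (∨-introʳ (relax e))) hyp₀

∧-intro : Γ ⊩ φ → Γ ⊩ ψ → Γ ⊩ φ ∧ ψ
∧-intro d e =
  ¬-intro (∨-elim (refute d) (refute e) hyp₀)
  where
  refute : Γ ⊩ φ → ψ ∷ Γ ⊩ ¬ φ ⊃ χ
  refute d = deduction (explode hyp₀ (weaken (there ∘ there) d))

∧-elimˡ : Γ ⊩ φ ∧ ψ → Γ ⊩ φ
∧-elimˡ d = by-contradiction (explode (weaken there d) (∨-introˡ hyp₀))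

∧-elimʳ : Γ ⊩ φ ∧ ψ → Γ ⊩ ψ
∧-elimʳ d = by-contradiction (explode (weaken there d) (∨-introʳ hyp₀))

-- The nonempty index set avoids choosing a verum for the empty conjunction, and gives the root the
-- successor that axiom D requires.
⋀ : ∀ {n} → (Fin (suc n) → Formula) → Formula
⋀ {zero}  f = f zero
⋀ {suc n} f = f zero ∧ ⋀ (f ∘ suc)

⋀-intro : ∀ n {f : Fin (suc n) → Formula} → (∀ i → Γ ⊩ f i) → Γ ⊩ ⋀ f
⋀-intro zero    d = d zero
⋀-intro (suc n) d = ∧-intro (d zero) (⋀-intro n (d ∘ suc))

⋀-elim : ∀ n {f : Fin (suc n) → Formula} → Γ ⊩ ⋀ f → ∀ i → Γ ⊩ f i
⋀-elim zero    d zero    = d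
⋀-elim (suc n) d zero    = ∧-elimˡ d
⋀-elim (suc n) d (suc i) = ⋀-elim n (∧-elimʳ d) i

⋀-cong : ∀ {n} {f g : Fin (suc n) → Formula} → (∀ i → f i ≡ g i) → ⋀ f ≡ ⋀ g
⋀-cong {n = zero}  f≗g = f≗g zero
⋀-cong {n = suc n} f≗g = cong₂ _∧_ (f≗g zero) (⋀-cong (f≗g ∘ suc))

-- Kripke semantics with formulas of `L₁` as truth values.

module Frame (n : ℕ) where

  data World : Set where
    root : World
    leaf : Fin (suc n) → World

  Valuation : Set
  Valuation = World → PropVar → Formula

  next : Modal.Logic → Fin (suc n) → World
  next Modal.KD  i = leaf i
  next Modal.KD4 i = leaf i
  next Modal.KB  i = root

  truth : Modal.Logic → Valuation → World → Modal.Formula → Formula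
  truth X V w        (Modal.var x) = V w x
  truth X V w        (Modal.¬ φ)   = ¬ truth X V w φ
  truth X V w        (φ Modal.∨ ψ) = truth X V w φ ∨ truth X V w ψ
  truth X V root     (Modal.□ φ)   = ⋀ λ i → truth X V (leaf i) φ
  truth X V (leaf i) (Modal.□ φ)   = truth X V (next X i) φ

  truth-substitute : ∀ X V σ w φ →
    truth X V w (Modal.substitute σ φ) ≡ truth X (λ v x → truth X V v (σ x)) w φ
  truth-substitute X V σ w        (Modal.var x) = refl
  truth-substitute X V σ w        (Modal.¬ φ)   = cong ¬_ (truth-substitute X V σ w φ)
  truth-substitute X V σ w        (φ Modal.∨ ψ) =
    cong₂ _∨_ (truth-substitute X V σ w φ) (truth-substitute X V σ w ψ)
  truth-substitute X V σ root     (Modal.□ φ)   =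
    ⋀-cong λ i → truth-substitute X V σ (leaf i) φ
  truth-substitute X V σ (leaf i) (Modal.□ φ)   = truth-substitute X V σ (next X i) φ

  classical-sound : ∀ X V w {φ} → Modal.Axiom φ → Axiom (truth X V w φ)
  classical-sound X V w (Modal.idem φ)     = idem _
  classical-sound X V w (Modal.add φ ψ)    = add _ _
  classical-sound X V w (Modal.perm φ ψ)   = perm _ _
  classical-sound X V w (Modal.summ φ ψ χ) = summ _ _ _

  ⋀⇒¬⋀¬ : (f : Fin (suc n) → Formula) → Γ ⊩ ⋀ f ⊃ ¬ ⋀ (λ i → ¬ f i)
  ⋀⇒¬⋀¬ f = deduction (¬-intro (explode (⋀-elim n hyp₀ zero) (⋀-elim n hyp₁ zero)))

  -- For KD and KD4 each leaf sees only itself, so there `◇ φ` is `φ` doubly negated, and `□ φ` and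
  -- `□ □ φ` have the same truth formula at every world. For KB, `◇ φ` at a leaf is the double
  -- negation of `φ` at the root; at the root it is witnessed by the leaf `i` one started from.
  schema-sound : ∀ {X φ} → Modal.Schema X φ → ∀ V w → [] ⊩ truth X V w φ
  schema-sound (Modal.KD-D φ)  V root     = ⋀⇒¬⋀¬ _
  schema-sound (Modal.KD-D φ)  V (leaf i) = deduction (¬¬-intro hyp₀)
  schema-sound (Modal.KD4-D φ) V root     = ⋀⇒¬⋀¬ _
  schema-sound (Modal.KD4-D φ) V (leaf i) = deduction (¬¬-intro hyp₀)
  schema-sound (Modal.KD4-4 φ) V root     = ⊃-refl
  schema-sound (Modal.KD4-4 φ) V (leaf i) = ⊃-refl
  schema-sound (Modal.KB-B φ)  V root     = deduction (⋀-intro n λ i → ¬¬-intro hyp₀)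
  schema-sound (Modal.KB-B φ)  V (leaf i) =
    deduction (¬-intro (explode (⋀-elim n hyp₀ i) hyp₁))

  -- The induction must range over all `V` because `sub` changes the valuation, and over all `w`
  -- because `nec` changes the world.
  sound : ∀ {X φ} → X Modal.⊢ φ → ∀ V w → [] ⊩ truth X V w φ
  sound (Modal.classical ax) V w        = axiom (classical-sound _ V w ax)
  sound (Modal.axK φ ψ)      V root     =
    deduction (deduction (⋀-intro n λ i → ⋀-elim n hyp₁ i · ⋀-elim n hyp₀ i))
  -- With a single successor, `□ (φ ⊃ ψ)` and `□ φ ⊃ □ ψ` have the same truth formula.
  sound (Modal.axK φ ψ)      V (leaf i) = ⊃-refl
  sound (Modal.schema s)     V w        = schema-sound s V w
  sound (Modal.mp d e)       V w        = sound d V w · sound e V w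
  sound {X} (Modal.sub {φ} σ d) V w     =
    subst ([] ⊩_) (sym (truth-substitute X V σ w φ)) (sound d _ w)
  sound (Modal.nec d)        V root     = ⋀-intro n λ i → sound d V (leaf i)
  sound {X} (Modal.nec d)    V (leaf i) = sound d V (next X i)

-- The valuation read off from `ε`.

names : Formula → List NameVar
names (ε a b) = a ∷ b ∷ []
names (¬ φ)   = names φ
names (φ ∨ ψ) = names φ ++ names ψ

module Canonical (p : NameVar ↣ PropVar) (d : NameVar) (ds : List NameVar) where

  open Injection p using (to; injective)
  open Frame (length ds)

  name : Fin (suc (length ds)) → NameVar
  name = lookup (d ∷ ds)

  atom : World → NameVar → Formula
  atom root     a = ε a a
  atom (leaf i) a = ε (name i) a

  valuation : Valuation
  valuation w x with any? (λ i → to (name i) ≟ x)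
  ... | yes (i , _) = atom w (name i)
  -- An arbitrary value for variables of no listed name.
  ... | no _        = ε d d

  valuation-to : ∀ {a} → a ∈ d ∷ ds → ∀ w → valuation w (to a) ≡ atom w a
  valuation-to {a} a∈ w with any? (λ i → to (name i) ≟ to a)
  -- The list may repeat names, so `i` need not be the position given by `a∈`; injectivity of `p`
  -- still yields `name i ≡ a`.
  ... | yes (i , eq) = cong (atom w) (injective eq)
  ... | no ∄i        = contradiction (index a∈ , cong to (sym (lookup-index a∈))) ∄i

  module _ (X : Modal.Logic) where

    atRoot : Formula → Formula
    atRoot φ = truth X valuation root (B p φ)

    -- Ax1 gives the conjunct `p_a`. At the leaf of `c`, Ax2 leads from `ε c a` to `ε c b`. If
    -- `ε b b` holds too, Ax3 gives `ε b a`, and Ax2 leads back from `ε c b` to `ε c a`.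
    ε⇒atRoot : ∀ a b → a ∈ d ∷ ds → b ∈ d ∷ ds → ε a b ∷ [] ⊩ atRoot (ε a b)
    ε⇒atRoot a b a∈ b∈
      rewrite valuation-to a∈ root | valuation-to b∈ root =
      ∧-intro (thm (ax1 a b) · hyp₀) (∧-intro (⋀-intro (length ds) left) (deduction (⋀-intro (length ds) right)))
      where
      left : ∀ i → ε a b ∷ [] ⊩ valuation (leaf i) (to a) ⊃ valuation (leaf i) (to b)
      left i rewrite valuation-to a∈ (leaf i) | valuation-to b∈ (leaf i) =
        deduction (thm (ax2 (name i) a b) · ∧-intro hyp₀ hyp₁)

      right : ∀ i → ε b b ∷ ε a b ∷ [] ⊩ valuation (leaf i) (to b) ⊃ valuation (leaf i) (to a)
      right i rewrite valuation-to a∈ (leaf i) | valuation-to b∈ (leaf i) =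
        deduction (thm (ax2 (name i) b a) · ∧-intro hyp₀ (weaken there εba))
        where
        εba : ε b b ∷ ε a b ∷ [] ⊩ ε b a
        εba = thm (ax3 a b b) · ∧-intro hyp₁ hyp₀

    -- The boxed implication `p_a ⊃ p_b`, evaluated at the leaf of `a` itself, is `ε a a ⊃ ε a b`.
    atRoot⇒ε : ∀ a b → a ∈ d ∷ ds → b ∈ d ∷ ds → atRoot (ε a b) ∷ [] ⊩ ε a b
    atRoot⇒ε a b a∈ b∈ = atLeaf · atTop
      where
      atTop : atRoot (ε a b) ∷ [] ⊩ ε a a
      atTop = subst (atRoot (ε a b) ∷ [] ⊩_) (valuation-to a∈ root) (∧-elimˡ hyp₀)

      name-index : name (index a∈) ≡ a
      name-index = sym (lookup-index a∈)

      atLeaf : atRoot (ε a b) ∷ [] ⊩ ε a a ⊃ ε a b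
      atLeaf = subst (atRoot (ε a b) ∷ [] ⊩_)
        (cong₂ _⊃_ (leaf-atom a∈) (leaf-atom b∈))
        (⋀-elim (length ds) (∧-elimˡ (∧-elimʳ hyp₀)) (index a∈))
        where
        leaf-atom : ∀ {c} → c ∈ d ∷ ds → valuation (leaf (index a∈)) (to c) ≡ ε a c
        leaf-atom {c} c∈ =
          trans (valuation-to c∈ (leaf (index a∈))) (cong (λ e → ε e c) name-index)

    -- Both directions go through one induction because negation exchanges them.
    atRoot⇔ : ∀ φ → names φ ⊆ d ∷ ds → (φ ∷ [] ⊩ atRoot φ) × (atRoot φ ∷ [] ⊩ φ)
    atRoot⇔ (ε a b) s = ε⇒atRoot a b a∈ b∈ , atRoot⇒ε a b a∈ b∈
      where
      a∈ = s (here refl)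
      b∈ = s (there (here refl))
    atRoot⇔ (¬ φ) s = let to , from = atRoot⇔ φ s in contrapose from , contrapose to
    atRoot⇔ (φ ∨ ψ) s =
      let toˡ , fromˡ = atRoot⇔ φ (s ∘ ∈-++⁺ˡ)
          toʳ , fromʳ = atRoot⇔ ψ (s ∘ ∈-++⁺ʳ (names φ))
      in ∨-map toˡ toʳ , ∨-map fromˡ fromʳ

theorem7p10 : (p : NameVar ↣ PropVar) (X : Modal.Logic) (φ : L₁.Formula) →
    X Modal.⊢ B p φ → L₁.⊢ φ
theorem7p10 p X φ ⊢Bφ =
  closed (deduction (proj₂ (atRoot⇔ X φ there)) · sound ⊢Bφ valuation root)
  where
  -- The spare name 0 only makes the set of leaves visibly nonempty.
  open Canonical p 0 (names φ)
  open Frame (length (names φ))
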